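{- Let $C\subseteq K$ be a Cartesian effect category with (left and right) sequential products $\ltimes,\rtimes$. Let $a,l,r,c$ be the natural isomorphisms on $C$ given by its finite products: $a_{X_1,X_2,X_3}:(X_1\times X_2)\times X_3\to X_1\times(X_2\times X_3)$, $l_X:X\times 1\to X$, $r_X:1\times X\to X$, $c_{X_1,X_2}:X_1\times X_2\to X_2\times X_1$. Let $J:C\to K$ be the inclusion, let $\otimes:|K|\times K\to K$ and $\otimes:K\times|K|\to K$ be the restrictions of $\ltimes$ and $\rtimes$, respectively, and let $I=1$. Then these data form a Freyd-category, and in this Freyd-category the graph homomorphisms $\ltimes_{\mathrm{Fr}}$ and $\rtimes_{\mathrm{Fr}}$ coincide with $\ltimes$ and $\rtimes$, respectively.
   Context: **Cartesian effect categories.** A subcategory $C$ of a category $K$ is wide if it has the same objects as $K$; morphisms of $K$ lying in $C$ are called pure. A pure terminal object is an object $1$ that is terminal in $C$, and $\langle\,\rangle_X:X\to 1$ denotes the unique pure morphism. The effect of $f:X\to Y$ in $K$ is $\mathcal{E}(f)=\langle\,\rangle_Y\circ f$; for $f:X\to Y$ and $f':X\to Y'$, write $f\approx f'$ iff $\mathcal{E}(f)=\mathcal{E}(f')$. A consistency relation $\lhd$ is a relation between parallel morphisms of $K$, the second one being pure, such that (i) $v\lhd v$ for every pure $v$; (ii) for all $f:X\to Y$, $g:Y\to Z$ in $K$ and all pure $u:Y\to Y'$, $v:X\to Y'$, $w:Y'\to Z$, if $u\circ f\lhd v$ and $g\lhd w\circ u$ then $g\circ f\lhd w\circ v$. Write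 $f\lhd\rhd f'$ iff there is a pure $v$ with $f\lhd v$ and $f'\lhd v$. An effect category consists of a category $K$, a wide subcategory $C$, a pure terminal object $1$ and a consistency relation $\lhd$ satisfying complementarity: for parallel $f,f'$, if $f\approx f'$ and $f\lhd\rhd f'$ then $f=f'$. A Cartesian effect category is an effect category in which $C$ has chosen finite products (terminal object $1$, binary products $\times$), together with two graph homomorphisms $\ltimes:C\times K\to K$ and $\rtimes:K\times C\to K$ (the semi-pure products), sending $(X_1,X_2)$ to $X_1\times X_2$ on objects, both extending $\times$ on pairs of pure morphisms, and such that, with projections $p_i:X_1\times X_2\to X_i$ and $q_i:Y_1\times Y_2\to Y_i$: for all pure $v_1:X_1\to Y_1$ and all $f_2:X_2\to Y_2$ in $K$, $v_1\ltimes f_2:X_1\times X_2\to Y_1\times Y_2$ is the unique morphism of $K$ with $q_1\circ(v_1\ltimes f_2)\lhd v_1\circ p_1$ and $q_2\circ(v_1\ltimes f_2)=f_2\circ p_2$; and for all $f_1:X_1\to Y_1$ in $K$ and all pure $v_2:X_2\to Y_2$, $f_1\rtimes v_2$ is the unique morphism of $K$ with $q_1\circ(f_1\rtimes v_2)=f_1\circ p_1$ and $q_2\circ(f_1\rtimes v_2)\lhd v_2\circ p_2$. **Sequential products.** For arbitrary $f_1:X_1\to Y_1$, $f_2:X_2\to Y_2$ in $K$, the left and right sequential products are $f_1\ltimes f_2=(\mathrm{id}_{Y_1}\ltimes f_2)\circ(f_1\rtimes\mathrm{id}_{X_2})$ and $f_1\rtimes f_2=(f_1\rtimes\mathrm{id}_{Y_2})\circ(\mathrm{id}_{X_1}\ltimes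 f_2)$, where semi-pure products are used on the right-hand sides. They extend the semi-pure products, so the same symbols are used. **Freyd-categories.** $|K|$ denotes the smallest wide subcategory of $K$ (objects and identities only). A binoidal category is a category $K$ with two functors $\otimes:|K|\times K\to K$ and $\otimes:K\times|K|\to K$ which coincide on $|K|^2$. In a binoidal category, for $f_1:X_1\to Y_1$ and $f_2:X_2\to Y_2$, put $f_1\ltimes_{\mathrm{Fr}}f_2=(\mathrm{id}_{Y_1}\otimes f_2)\circ(f_1\otimes\mathrm{id}_{X_2})$ and $f_1\rtimes_{\mathrm{Fr}}f_2=(f_1\otimes\mathrm{id}_{Y_2})\circ(\mathrm{id}_{X_1}\otimes f_2)$. A morphism $k$ is central if for all $f$ in $K$, $k\ltimes_{\mathrm{Fr}}f=k\rtimes_{\mathrm{Fr}}f$ and $f\ltimes_{\mathrm{Fr}}k=f\rtimes_{\mathrm{Fr}}k$. A natural transformation is central if all its components are. A symmetric premonoidal category is a binoidal category $K$ with an object $I$ and central natural isomorphisms (natural in each component separately) $a_{X,Y,Z}:(X\otimes Y)\otimes Z\to X\otimes(Y\otimes Z)$, $l_X:X\otimes I\to X$, $r_X:I\otimes X\to X$, $c_{X,Y}:X\otimes Y\to Y\otimes X$, subject to the usual coherence equations for symmetric monoidal categories. A symmetric premonoidal functor between symmetric premonoidal categories is a functor that preserves $\otimes$, $I$ and $a,l,r,c$; it is strict if in addition it maps central morphisms to central morphisms. Every category with finite products is symmetric premonoidal, with $\otimes=\times$. A Freyd-category is an identity-on-objects functor $J:C\to K$ where $C$ has finite products, $K$ is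 symmetric premonoidal and $J$ is strict symmetric premonoidal. -}

module Defs where

open import Level using (Level; _⊔_) renaming (suc to lsuc)
open import Data.Product using (Σ; _×_; _,_; proj₁; proj₂; ∃-syntax; uncurry)
open import Function using (id)
open import Relation.Binary.Structures using (IsEquivalence)

private
  variable
    o o′ ℓ ℓ′ e e′ p κ : Level

-- Hom-sets are setoids.  The collection of objects is a parameter, so that
-- "wide subcategory" and "identity on objects" need no equality of objects.

record Category (Obj : Set o) (ℓ e : Level) : Set (o ⊔ lsuc (ℓ ⊔ e)) where
  infix  4 _⇒_ _≈_
  infixr 9 _∘_
  field
    _⇒_ : Obj → Obj → Set ℓ
    _≈_ : ∀ {X Y} → X ⇒ Y → X ⇒ Y → Set e
    idₘ : ∀ {X} → X ⇒ X
    _∘_ : ∀ {X Y Z} → Y ⇒ Z → X ⇒ Y → X ⇒ Z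

    equiv     : ∀ {X Y} → IsEquivalence (_≈_ {X} {Y})
    ∘-resp-≈  : ∀ {X Y Z} {g g′ : Y ⇒ Z} {f f′ : X ⇒ Y} →
                g ≈ g′ → f ≈ f′ → g ∘ f ≈ g′ ∘ f′
    assoc     : ∀ {W X Y Z} {f : W ⇒ X} {g : X ⇒ Y} {h : Y ⇒ Z} →
                (h ∘ g) ∘ f ≈ h ∘ (g ∘ f)
    identityˡ : ∀ {X Y} {f : X ⇒ Y} → idₘ ∘ f ≈ f
    identityʳ : ∀ {X Y} {f : X ⇒ Y} → f ∘ idₘ ≈ f

  module _ {X Y : Obj} where
    open IsEquivalence (equiv {X} {Y}) public
      using () renaming (refl to ≈-refl; sym to ≈-sym; trans to ≈-trans)

infixr 2 _×ᶜ_

_×ᶜ_ : {A : Set o} {B : Set o′} → Category A ℓ e → Category B ℓ′ e′ →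
       Category (A × B) (ℓ ⊔ ℓ′) (e ⊔ e′)
C ×ᶜ D = record
  { _⇒_       = λ X Y → (proj₁ X C.⇒ proj₁ Y) × (proj₂ X D.⇒ proj₂ Y)
  ; _≈_       = λ f g → (proj₁ f C.≈ proj₁ g) × (proj₂ f D.≈ proj₂ g)
  ; idₘ       = C.idₘ , D.idₘ
  ; _∘_       = λ g f → (proj₁ g C.∘ proj₁ f) , (proj₂ g D.∘ proj₂ f)
  ; equiv     = record
    { refl  = C.≈-refl , D.≈-refl
    ; sym   = λ q → C.≈-sym (proj₁ q) , D.≈-sym (proj₂ q)
    ; trans = λ q s → C.≈-trans (proj₁ q) (proj₁ s) , D.≈-trans (proj₂ q) (proj₂ s)
    }
  ; ∘-resp-≈  = λ q s → C.∘-resp-≈ (proj₁ q) (proj₁ s) , D.∘-resp-≈ (proj₂ q) (proj₂ s)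
  ; assoc     = C.assoc , D.assoc
  ; identityˡ = C.identityˡ , D.identityˡ
  ; identityʳ = C.identityʳ , D.identityʳ
  }
  where
  module C = Category C
  module D = Category D

-- The map on objects is an index, so that two graph homomorphisms agreeing on
-- objects can be compared on morphisms.

record GraphHom {A : Set o} {B : Set o′} (C : Category A ℓ e)
                (D : Category B ℓ′ e′) (F₀ : A → B) : Set (o ⊔ ℓ ⊔ e ⊔ ℓ′ ⊔ e′) where
  private
    module C = Category C
    module D = Category D
  field
    F₁       : ∀ {X Y} → X C.⇒ Y → F₀ X D.⇒ F₀ Y
    F-resp-≈ : ∀ {X Y} {f g : X C.⇒ Y} → f C.≈ g → F₁ f D.≈ F₁ g

record IsFunctor {A : Set o} {B : Set o′} {C : Category A ℓ e} {D : Category B ℓ′ e′}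
                 {F₀ : A → B} (F : GraphHom C D F₀) : Set (o ⊔ ℓ ⊔ e′) where
  private
    module C = Category C
    module D = Category D
  open GraphHom F
  field
    identity     : ∀ {X} → F₁ (C.idₘ {X}) D.≈ D.idₘ
    homomorphism : ∀ {X Y Z} (f : X C.⇒ Y) (g : Y C.⇒ Z) →
                   F₁ (g C.∘ f) D.≈ F₁ g D.∘ F₁ f

module _ {Obj : Set o} (K : Category Obj ℓ e) where
  open Category K

  record IsIso {X Y : Obj} (f : X ⇒ Y) : Set (ℓ ⊔ e) where
    field
      inv  : Y ⇒ X
      isoˡ : inv ∘ f ≈ idₘ
      isoʳ : f ∘ inv ≈ idₘ

record WideSubcategory {Obj : Set o} (K : Category Obj ℓ e) (p : Level) :
                       Set (o ⊔ ℓ ⊔ e ⊔ lsuc p) where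
  open Category K
  field
    Pure        : ∀ {X Y} → X ⇒ Y → Set p
    pure-resp-≈ : ∀ {X Y} {f g : X ⇒ Y} → f ≈ g → Pure f → Pure g
    pure-id     : ∀ {X} → Pure (idₘ {X})
    pure-∘      : ∀ {X Y Z} {g : Y ⇒ Z} {f : X ⇒ Y} → Pure g → Pure f → Pure (g ∘ f)

  category : Category Obj (ℓ ⊔ p) e
  category = record
    { _⇒_       = λ X Y → Σ (X ⇒ Y) Pure
    ; _≈_       = λ v w → proj₁ v ≈ proj₁ w
    ; idₘ       = idₘ , pure-id
    ; _∘_       = λ w v → proj₁ w ∘ proj₁ v , pure-∘ (proj₂ w) (proj₂ v)
    ; equiv     = record { refl = ≈-refl ; sym = ≈-sym ; trans = ≈-trans }
    ; ∘-resp-≈  = ∘-resp-≈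
    ; assoc     = assoc
    ; identityˡ = identityˡ
    ; identityʳ = identityʳ
    }

  inclusion : GraphHom category K id
  inclusion = record { F₁ = proj₁ ; F-resp-≈ = id }

module _ {Obj : Set o} (K : Category Obj ℓ e) where
  open Category K

  -- Closed under ≈, since membership in a subcategory must respect equality.
  data IsIdentity {X : Obj} : {Y : Obj} → X ⇒ Y → Set (ℓ ⊔ e) where
    is-id : {f : X ⇒ X} → f ≈ idₘ → IsIdentity f

  identities : WideSubcategory K (ℓ ⊔ e)
  identities = record
    { Pure        = IsIdentity
    ; pure-resp-≈ = λ { f≈g (is-id q) → is-id (≈-trans (≈-sym f≈g) q) }
    ; pure-id     = is-id ≈-refl
    ; pure-∘      = λ { (is-id q) (is-id s) → is-id (≈-trans (∘-resp-≈ q s) identityˡ) }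
    }

  ∣_∣ : Category Obj (ℓ ⊔ e) e
  ∣_∣ = WideSubcategory.category identities

  restrictˡ : {F₀ : Obj × Obj → Obj} → GraphHom (K ×ᶜ K) K F₀ → GraphHom (∣_∣ ×ᶜ K) K F₀
  restrictˡ F = record
    { F₁       = λ (u , f) → F₁ (proj₁ u , f)
    ; F-resp-≈ = λ q → F-resp-≈ q
    }
    where open GraphHom F

  restrictʳ : {F₀ : Obj × Obj → Obj} → GraphHom (K ×ᶜ K) K F₀ → GraphHom (K ×ᶜ ∣_∣) K F₀
  restrictʳ F = record
    { F₁       = λ (f , u) → F₁ (f , proj₁ u)
    ; F-resp-≈ = λ q → F-resp-≈ q
    }
    where open GraphHom F

record Terminal {Obj : Set o} (C : Category Obj ℓ e) : Set (o ⊔ ℓ ⊔ e) where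
  open Category C
  field
    𝟏        : Obj
    !        : ∀ {X} → X ⇒ 𝟏
    !-unique : ∀ {X} (f : X ⇒ 𝟏) → f ≈ !

record BinaryProducts {Obj : Set o} (C : Category Obj ℓ e) : Set (o ⊔ ℓ ⊔ e) where
  open Category C
  infixr 7 _⊠_
  field
    _⊠_      : Obj → Obj → Obj
    π₁       : ∀ {X Y} → X ⊠ Y ⇒ X
    π₂       : ∀ {X Y} → X ⊠ Y ⇒ Y
    ⟨_,_⟩    : ∀ {X Y Z} → Z ⇒ X → Z ⇒ Y → Z ⇒ X ⊠ Y
    project₁ : ∀ {X Y Z} {f : Z ⇒ X} {g : Z ⇒ Y} → π₁ ∘ ⟨ f , g ⟩ ≈ f
    project₂ : ∀ {X Y Z} {f : Z ⇒ X} {g : Z ⇒ Y} → π₂ ∘ ⟨ f , g ⟩ ≈ g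
    unique   : ∀ {X Y Z} {f : Z ⇒ X} {g : Z ⇒ Y} {h : Z ⇒ X ⊠ Y} →
               π₁ ∘ h ≈ f → π₂ ∘ h ≈ g → h ≈ ⟨ f , g ⟩

  product : GraphHom (C ×ᶜ C) C (uncurry _⊠_)
  product = record
    { F₁       = λ (f , g) → ⟨ f ∘ π₁ , g ∘ π₂ ⟩
    ; F-resp-≈ = λ (q , s) → unique (≈-trans project₁ (∘-resp-≈ q ≈-refl))
                                    (≈-trans project₂ (∘-resp-≈ s ≈-refl))
    }

  infixr 8 _⊠₁_
  _⊠₁_ : ∀ {X₁ X₂ Y₁ Y₂} → X₁ ⇒ Y₁ → X₂ ⇒ Y₂ → X₁ ⊠ X₂ ⇒ Y₁ ⊠ Y₂
  f ⊠₁ g = GraphHom.F₁ product (f , g)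

record EffectCategory (Obj : Set o) (ℓ e p κ : Level) :
                      Set (o ⊔ lsuc (ℓ ⊔ e ⊔ p ⊔ κ)) where
  field
    K : Category Obj ℓ e
    C : WideSubcategory K p

  open Category K public
  module Cᶜ = Category (WideSubcategory.category C)

  infix 4 _⇝_
  _⇝_ : Obj → Obj → Set (ℓ ⊔ p)
  _⇝_ = Cᶜ._⇒_

  J : ∀ {X Y} → X ⇝ Y → X ⇒ Y
  J = GraphHom.F₁ (WideSubcategory.inclusion C)

  field
    terminal : Terminal (WideSubcategory.category C)

  open Terminal terminal public

  ℰ : ∀ {X Y} → X ⇒ Y → X ⇒ 𝟏
  ℰ f = J ! ∘ f

  infix 4 _≈ᴱ_
  _≈ᴱ_ : ∀ {X Y Y′} → X ⇒ Y → X ⇒ Y′ → Set e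
  f ≈ᴱ f′ = ℰ f ≈ ℰ f′

  -- ◁ relates elements of hom-setoids, hence respects their equality.
  infix 4 _◁_
  field
    _◁_      : ∀ {X Y} → X ⇒ Y → X ⇝ Y → Set κ
    ◁-resp-≈ : ∀ {X Y} {f f′ : X ⇒ Y} {v v′ : X ⇝ Y} →
               f ≈ f′ → J v ≈ J v′ → f ◁ v → f′ ◁ v′
    ◁-pure   : ∀ {X Y} (v : X ⇝ Y) → J v ◁ v
    ◁-∘      : ∀ {X Y Y′ Z} (f : X ⇒ Y) (g : Y ⇒ Z)
               (u : Y ⇝ Y′) (v : X ⇝ Y′) (w : Y′ ⇝ Z) →
               J u ∘ f ◁ v → g ◁ w Cᶜ.∘ u → g ∘ f ◁ w Cᶜ.∘ v

  infix 4 _◁▷_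
  _◁▷_ : ∀ {X Y} → X ⇒ Y → X ⇒ Y → Set (ℓ ⊔ p ⊔ κ)
  f ◁▷ f′ = ∃[ v ] (f ◁ v × f′ ◁ v)

  field
    complementarity : ∀ {X Y} {f f′ : X ⇒ Y} → f ≈ᴱ f′ → f ◁▷ f′ → f ≈ f′

record CartesianEffectCategory (Obj : Set o) (ℓ e p κ : Level) :
                               Set (o ⊔ lsuc (ℓ ⊔ e ⊔ p ⊔ κ)) where
  field
    effectCategory : EffectCategory Obj ℓ e p κ

  open EffectCategory effectCategory public

  field
    products : BinaryProducts (WideSubcategory.category C)

  open BinaryProducts products public

  field
    semipureˡ : GraphHom (WideSubcategory.category C ×ᶜ K) K (uncurry _⊠_)
    semipureʳ : GraphHom (K ×ᶜ WideSubcategory.category C) K (uncurry _⊠_)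

  infixr 8 _⋉ₛ_ _⋊ₛ_
  _⋉ₛ_ : ∀ {X₁ X₂ Y₁ Y₂} → X₁ ⇝ Y₁ → X₂ ⇒ Y₂ → X₁ ⊠ X₂ ⇒ Y₁ ⊠ Y₂
  v ⋉ₛ f = GraphHom.F₁ semipureˡ (v , f)

  _⋊ₛ_ : ∀ {X₁ X₂ Y₁ Y₂} → X₁ ⇒ Y₁ → X₂ ⇝ Y₂ → X₁ ⊠ X₂ ⇒ Y₁ ⊠ Y₂
  f ⋊ₛ v = GraphHom.F₁ semipureʳ (f , v)

  field
    ⋉ₛ-extends : ∀ {X₁ X₂ Y₁ Y₂} (v₁ : X₁ ⇝ Y₁) (v₂ : X₂ ⇝ Y₂) →
                 v₁ ⋉ₛ J v₂ ≈ J (v₁ ⊠₁ v₂)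
    ⋊ₛ-extends : ∀ {X₁ X₂ Y₁ Y₂} (v₁ : X₁ ⇝ Y₁) (v₂ : X₂ ⇝ Y₂) →
                 J v₁ ⋊ₛ v₂ ≈ J (v₁ ⊠₁ v₂)

    ⋉ₛ-proj₁  : ∀ {X₁ X₂ Y₁ Y₂} (v₁ : X₁ ⇝ Y₁) (f₂ : X₂ ⇒ Y₂) →
                J π₁ ∘ (v₁ ⋉ₛ f₂) ◁ v₁ Cᶜ.∘ π₁
    ⋉ₛ-proj₂  : ∀ {X₁ X₂ Y₁ Y₂} (v₁ : X₁ ⇝ Y₁) (f₂ : X₂ ⇒ Y₂) →
                J π₂ ∘ (v₁ ⋉ₛ f₂) ≈ f₂ ∘ J π₂
    ⋉ₛ-unique : ∀ {X₁ X₂ Y₁ Y₂} (v₁ : X₁ ⇝ Y₁) (f₂ : X₂ ⇒ Y₂) (m : X₁ ⊠ X₂ ⇒ Y₁ ⊠ Y₂) →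
                J π₁ ∘ m ◁ v₁ Cᶜ.∘ π₁ → J π₂ ∘ m ≈ f₂ ∘ J π₂ → m ≈ v₁ ⋉ₛ f₂

    ⋊ₛ-proj₁  : ∀ {X₁ X₂ Y₁ Y₂} (f₁ : X₁ ⇒ Y₁) (v₂ : X₂ ⇝ Y₂) →
                J π₁ ∘ (f₁ ⋊ₛ v₂) ≈ f₁ ∘ J π₁
    ⋊ₛ-proj₂  : ∀ {X₁ X₂ Y₁ Y₂} (f₁ : X₁ ⇒ Y₁) (v₂ : X₂ ⇝ Y₂) →
                J π₂ ∘ (f₁ ⋊ₛ v₂) ◁ v₂ Cᶜ.∘ π₂
    ⋊ₛ-unique : ∀ {X₁ X₂ Y₁ Y₂} (f₁ : X₁ ⇒ Y₁) (v₂ : X₂ ⇝ Y₂) (m : X₁ ⊠ X₂ ⇒ Y₁ ⊠ Y₂) →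
                J π₁ ∘ m ≈ f₁ ∘ J π₁ → J π₂ ∘ m ◁ v₂ Cᶜ.∘ π₂ → m ≈ f₁ ⋊ₛ v₂

  sequentialˡ : GraphHom (K ×ᶜ K) K (uncurry _⊠_)
  sequentialˡ = record
    { F₁       = λ (f₁ , f₂) → (Cᶜ.idₘ ⋉ₛ f₂) ∘ (f₁ ⋊ₛ Cᶜ.idₘ)
    ; F-resp-≈ = λ (q₁ , q₂) → ∘-resp-≈ (GraphHom.F-resp-≈ semipureˡ (≈-refl , q₂))
                                        (GraphHom.F-resp-≈ semipureʳ (q₁ , ≈-refl))
    }

  sequentialʳ : GraphHom (K ×ᶜ K) K (uncurry _⊠_)
  sequentialʳ = record
    { F₁       = λ (f₁ , f₂) → (f₁ ⋊ₛ Cᶜ.idₘ) ∘ (Cᶜ.idₘ ⋉ₛ f₂)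
    ; F-resp-≈ = λ (q₁ , q₂) → ∘-resp-≈ (GraphHom.F-resp-≈ semipureʳ (q₁ , ≈-refl))
                                        (GraphHom.F-resp-≈ semipureˡ (≈-refl , q₂))
    }

  infixr 8 _⋉_ _⋊_
  _⋉_ _⋊_ : ∀ {X₁ X₂ Y₁ Y₂} → X₁ ⇒ Y₁ → X₂ ⇒ Y₂ → X₁ ⊠ X₂ ⇒ Y₁ ⊠ Y₂
  f₁ ⋉ f₂ = GraphHom.F₁ sequentialˡ (f₁ , f₂)
  f₁ ⋊ f₂ = GraphHom.F₁ sequentialʳ (f₁ , f₂)

-- Structures (…Data) are separated from their axioms (Is…), so that one can
-- say that given data form a structure of the required kind.

record BinoidalData {Obj : Set o} (K : Category Obj ℓ e) (_⊗_ : Obj → Obj → Obj) :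
                    Set (o ⊔ ℓ ⊔ e) where
  open Category K
  field
    ⊗ˡ : GraphHom (∣ K ∣ ×ᶜ K) K (uncurry _⊗_)
    ⊗ʳ : GraphHom (K ×ᶜ ∣ K ∣) K (uncurry _⊗_)

  id[_]⊗_ : ∀ X {Y Z} → Y ⇒ Z → (X ⊗ Y) ⇒ (X ⊗ Z)
  id[ X ]⊗ f = GraphHom.F₁ ⊗ˡ (Category.idₘ ∣ K ∣ {X} , f)

  _⊗id[_] : ∀ {Y Z} → Y ⇒ Z → ∀ X → (Y ⊗ X) ⇒ (Z ⊗ X)
  f ⊗id[ X ] = GraphHom.F₁ ⊗ʳ (f , Category.idₘ ∣ K ∣ {X})

  infixr 8 _⋉Fr_ _⋊Fr_
  _⋉Fr_ _⋊Fr_ : ∀ {X₁ X₂ Y₁ Y₂} → X₁ ⇒ Y₁ → X₂ ⇒ Y₂ → (X₁ ⊗ X₂) ⇒ (Y₁ ⊗ Y₂)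
  _⋉Fr_ {X₁} {X₂} {Y₁} {Y₂} f₁ f₂ = (id[ Y₁ ]⊗ f₂) ∘ (f₁ ⊗id[ X₂ ])
  _⋊Fr_ {X₁} {X₂} {Y₁} {Y₂} f₁ f₂ = (f₁ ⊗id[ Y₂ ]) ∘ (id[ X₁ ]⊗ f₂)

  Central : ∀ {X Y} → X ⇒ Y → Set (o ⊔ ℓ ⊔ e)
  Central k = ∀ {X′ Y′} (f : X′ ⇒ Y′) → (k ⋉Fr f ≈ k ⋊Fr f) × (f ⋉Fr k ≈ f ⋊Fr k)

record IsBinoidal {Obj : Set o} {K : Category Obj ℓ e} {_⊗_ : Obj → Obj → Obj}
                  (B : BinoidalData K _⊗_) : Set (o ⊔ ℓ ⊔ e) where
  open Category K
  open BinoidalData B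
  field
    ⊗ˡ-isFunctor : IsFunctor ⊗ˡ
    ⊗ʳ-isFunctor : IsFunctor ⊗ʳ
    ⊗-coincide   : ∀ {X₁ X₂ Y₁ Y₂} (u₁ : Category._⇒_ ∣ K ∣ X₁ Y₁)
                   (u₂ : Category._⇒_ ∣ K ∣ X₂ Y₂) →
                   GraphHom.F₁ ⊗ˡ (u₁ , proj₁ u₂) ≈ GraphHom.F₁ ⊗ʳ (proj₁ u₁ , u₂)

record SymmetricPremonoidalData {Obj : Set o} (K : Category Obj ℓ e)
                                (_⊗_ : Obj → Obj → Obj) (I : Obj) : Set (o ⊔ ℓ ⊔ e) where
  open Category K
  field
    binoidal : BinoidalData K _⊗_
    a : ∀ X Y Z → ((X ⊗ Y) ⊗ Z) ⇒ (X ⊗ (Y ⊗ Z))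
    l : ∀ X → (X ⊗ I) ⇒ X
    r : ∀ X → (I ⊗ X) ⇒ X
    c : ∀ X Y → (X ⊗ Y) ⇒ (Y ⊗ X)

  open BinoidalData binoidal public

record IsSymmetricPremonoidal {Obj : Set o} {K : Category Obj ℓ e}
                              {_⊗_ : Obj → Obj → Obj} {I : Obj}
                              (P : SymmetricPremonoidalData K _⊗_ I) : Set (o ⊔ ℓ ⊔ e) where
  open Category K
  open SymmetricPremonoidalData P
  field
    isBinoidal : IsBinoidal binoidal

    a-iso : ∀ X Y Z → IsIso K (a X Y Z)
    l-iso : ∀ X → IsIso K (l X)
    r-iso : ∀ X → IsIso K (r X)
    c-iso : ∀ X Y → IsIso K (c X Y)

    a-central : ∀ X Y Z → Central (a X Y Z)
    l-central : ∀ X → Central (l X)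
    r-central : ∀ X → Central (r X)
    c-central : ∀ X Y → Central (c X Y)

    a-natural₁ : ∀ {X X′} (f : X ⇒ X′) Y Z →
                 a X′ Y Z ∘ ((f ⊗id[ Y ]) ⊗id[ Z ]) ≈ (f ⊗id[ Y ⊗ Z ]) ∘ a X Y Z
    a-natural₂ : ∀ X {Y Y′} (f : Y ⇒ Y′) Z →
                 a X Y′ Z ∘ ((id[ X ]⊗ f) ⊗id[ Z ]) ≈ (id[ X ]⊗ (f ⊗id[ Z ])) ∘ a X Y Z
    a-natural₃ : ∀ X Y {Z Z′} (f : Z ⇒ Z′) →
                 a X Y Z′ ∘ (id[ X ⊗ Y ]⊗ f) ≈ (id[ X ]⊗ (id[ Y ]⊗ f)) ∘ a X Y Z
    l-natural  : ∀ {X X′} (f : X ⇒ X′) → l X′ ∘ (f ⊗id[ I ]) ≈ f ∘ l X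
    r-natural  : ∀ {X X′} (f : X ⇒ X′) → r X′ ∘ (id[ I ]⊗ f) ≈ f ∘ r X
    c-natural₁ : ∀ {X X′} (f : X ⇒ X′) Y → c X′ Y ∘ (f ⊗id[ Y ]) ≈ (id[ Y ]⊗ f) ∘ c X Y
    c-natural₂ : ∀ X {Y Y′} (f : Y ⇒ Y′) → c X Y′ ∘ (id[ X ]⊗ f) ≈ (f ⊗id[ X ]) ∘ c X Y

    pentagon : ∀ W X Y Z →
               (id[ W ]⊗ a X Y Z) ∘ a W (X ⊗ Y) Z ∘ (a W X Y ⊗id[ Z ])
                 ≈ a W X (Y ⊗ Z) ∘ a (W ⊗ X) Y Z
    triangle : ∀ X Y → (id[ X ]⊗ r Y) ∘ a X I Y ≈ (l X ⊗id[ Y ])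
    hexagon  : ∀ X Y Z →
               (id[ Y ]⊗ c X Z) ∘ a Y X Z ∘ (c X Y ⊗id[ Z ])
                 ≈ a Y Z X ∘ c X (Y ⊗ Z) ∘ a X Y Z
    c-unit   : ∀ X → r X ∘ c X I ≈ l X
    c-invol  : ∀ X Y → c Y X ∘ c X Y ≈ idₘ

-- Functors that are the identity on objects: preservation of ⊗ and I on
-- objects is expressed by the two structures sharing _⊗_ and I.

record IsSymmetricPremonoidalFunctor
         {Obj : Set o} {C : Category Obj ℓ e} {K : Category Obj ℓ′ e′}
         {_⊗_ : Obj → Obj → Obj} {I : Obj}
         (P : SymmetricPremonoidalData C _⊗_ I) (Q : SymmetricPremonoidalData K _⊗_ I)
         (J : GraphHom C K id) : Set (o ⊔ ℓ ⊔ e′) where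
  private
    module C = Category C
    module P = SymmetricPremonoidalData P
    module Q = SymmetricPremonoidalData Q
  open Category K
  open GraphHom J
  field
    isFunctor    : IsFunctor J
    -- Every morphism of ∣ C ∣ is an identity, so these cover all arguments of ⊗.
    preserves-⊗ˡ : ∀ X {Y Z} (f : Y C.⇒ Z) → F₁ (P.id[ X ]⊗ f) ≈ Q.id[ X ]⊗ F₁ f
    preserves-⊗ʳ : ∀ {Y Z} (f : Y C.⇒ Z) X → F₁ (f P.⊗id[ X ]) ≈ F₁ f Q.⊗id[ X ]
    preserves-a  : ∀ X Y Z → F₁ (P.a X Y Z) ≈ Q.a X Y Z
    preserves-l  : ∀ X → F₁ (P.l X) ≈ Q.l X
    preserves-r  : ∀ X → F₁ (P.r X) ≈ Q.r X
    preserves-c  : ∀ X Y → F₁ (P.c X Y) ≈ Q.c X Y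

record IsStrictSymmetricPremonoidalFunctor
         {Obj : Set o} {C : Category Obj ℓ e} {K : Category Obj ℓ′ e′}
         {_⊗_ : Obj → Obj → Obj} {I : Obj}
         (P : SymmetricPremonoidalData C _⊗_ I) (Q : SymmetricPremonoidalData K _⊗_ I)
         (J : GraphHom C K id) : Set (o ⊔ ℓ ⊔ e ⊔ ℓ′ ⊔ e′) where
  private
    module C = Category C
    module P = SymmetricPremonoidalData P
    module Q = SymmetricPremonoidalData Q
  open GraphHom J
  field
    isSymmetricPremonoidalFunctor : IsSymmetricPremonoidalFunctor P Q J
    preserves-central : ∀ {X Y} (k : X C.⇒ Y) → P.Central k → Q.Central (F₁ k)

module _ {Obj : Set o} {C : Category Obj ℓ e} (T : Terminal C) (B : BinaryProducts C) where
  open Category C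
  open Terminal T
  open BinaryProducts B

  cartesian : SymmetricPremonoidalData C _⊠_ 𝟏
  cartesian = record
    { binoidal = record { ⊗ˡ = restrictˡ C product ; ⊗ʳ = restrictʳ C product }
    ; a = λ _ _ _ → ⟨ π₁ ∘ π₁ , ⟨ π₂ ∘ π₁ , π₂ ⟩ ⟩
    ; l = λ _ → π₁
    ; r = λ _ → π₂
    ; c = λ _ _ → ⟨ π₂ , π₁ ⟩
    }

record FreydData (Obj : Set o) (ℓ e ℓ′ e′ : Level) :
                 Set (o ⊔ lsuc (ℓ ⊔ e ⊔ ℓ′ ⊔ e′)) where
  field
    C        : Category Obj ℓ e
    terminal : Terminal C
    products : BinaryProducts C
    K        : Category Obj ℓ′ e′

  open Terminal terminal using (𝟏)
  open BinaryProducts products using (_⊠_)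

  field
    premonoidal : SymmetricPremonoidalData K _⊠_ 𝟏
    J           : GraphHom C K id

record IsFreydCategory {Obj : Set o} (D : FreydData Obj ℓ e ℓ′ e′) :
                       Set (o ⊔ ℓ ⊔ e ⊔ ℓ′ ⊔ e′) where
  open FreydData D
  field
    isSymmetricPremonoidal : IsSymmetricPremonoidal premonoidal
    isStrict : IsStrictSymmetricPremonoidalFunctor (cartesian terminal products) premonoidal J

module _ {Obj : Set o} (E : CartesianEffectCategory Obj ℓ e p κ) where
  open CartesianEffectCategory E

  freydData : FreydData Obj (ℓ ⊔ p) e ℓ e
  freydData = record
    { C           = WideSubcategory.category C
    ; terminal    = terminal
    ; products    = products
    ; K           = K
    ; premonoidal = record
      { binoidal = record { ⊗ˡ = restrictˡ K sequentialˡ ; ⊗ʳ = restrictʳ K sequentialʳ }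
      ; a = λ X Y Z → J (×.a X Y Z)
      ; l = λ X → J (×.l X)
      ; r = λ X → J (×.r X)
      ; c = λ X Y → J (×.c X Y)
      }
    ; J           = WideSubcategory.inclusion C
    }
    where module × = SymmetricPremonoidalData (cartesian terminal products)

{-# OPTIONS --safe #-}
module Submission where

-- The proof rests on one observation: semi-pure products compose,
--
--   (w ⋉ₛ g) ∘ (v ⋉ₛ f) ≈ (w ∘ v) ⋉ₛ (g ∘ f)   (⋉ₛ-∘, and ⋊ₛ-∘ on the right).
--
-- By the uniqueness of semi-pure products this is a claim about the two
-- projections: the second one is an equality, and the first one is exactly
-- condition (ii) on consistency relations, used with u = π₁.  Three
-- consequences follow.
--
-- * The restrictions of ⋉ and ⋊ are functors, since on an identity the
--   sequential product is the semi-pure product.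
--
-- * Pure morphisms are central: for pure v both sequential products of v
--   and f collapse to v ⋉ₛ f, and those of f and v to f ⋊ₛ v.  So a, l, r, c are
--   central, and the inclusion J preserves centrality.
--
-- * a and c are natural.  Conjugating a semi-pure product by the pure
--   isomorphism in question yields a morphism whose projections can be computed,
--   and uniqueness identifies it with the other semi-pure product; for c,
--   one of the two squares then follows by inverting the other.  For a,
--   the direction of conjugation matters.  For instance, for
--   f ⋊ id at X ⊠ (Y ⊠ Z), the first projection of a⁻¹ ∘ (f ⋊ id) ∘ a is
--   (id ⊠₁ π₁) ∘ (f ⋊ id) ∘ a, where the pure factor can be moved
--   across f ⋊ id, and the second is a pure morphism composed with one that is
--   consistent with a pure morphism.  Computing a ∘ ((f ⋊ id) ⋊ id) ∘ a⁻¹ instead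
--   would call for the consistency of a pair to follow from that of its
--   components, which is not an axiom.
--
-- Naturality of l and r is the defining equation of a semi-pure product, and the
-- coherence equations involve only pure morphisms, so they hold in K because they
-- hold in C, where they are checked on generalized elements.

open import Defs
open import Level using (Level)
open import Data.Product using (_×_; _,_)
open import Relation.Binary.Bundles using (Setoid)
import Relation.Binary.Reasoning.Setoid as SetoidReasoning

private
  variable
    o ℓ e p κ : Level

module HomReasoning {Obj : Set o} (K : Category Obj ℓ e) where
  open Category K

  homSetoid : Obj → Obj → Setoid ℓ e
  homSetoid X Y = record { Carrier = X ⇒ Y ; _≈_ = _≈_ ; isEquivalence = equiv }

  module _ {X Y : Obj} where
    open SetoidReasoning (homSetoid X Y) public

  infixr 4 _⟩∘_ _∘⟨_
  _⟩∘_ : ∀ {X Y Z} {g g′ : Y ⇒ Z} → g ≈ g′ → (f : X ⇒ Y) → g ∘ f ≈ g′ ∘ f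
  q ⟩∘ f = ∘-resp-≈ q ≈-refl

  _∘⟨_ : ∀ {X Y Z} (g : Y ⇒ Z) {f f′ : X ⇒ Y} → f ≈ f′ → g ∘ f ≈ g ∘ f′
  g ∘⟨ q = ∘-resp-≈ ≈-refl q

  -- A square j ∘ m ≈ n ∘ i with one of i, j invertible commutes as soon as
  -- transporting one of m, n along that isomorphism yields the other.
  module _ {X Y X′ Y′} {i : X ⇒ Y} {j : X′ ⇒ Y′} {m : X ⇒ X′} {n : Y ⇒ Y′} where

    conjugateˡ : (j-iso : IsIso K j) → IsIso.inv j-iso ∘ (n ∘ i) ≈ m → j ∘ m ≈ n ∘ i
    conjugateˡ j-iso q = begin
      j ∘ m                      ≈⟨ j ∘⟨ q ⟨
      j ∘ (inv ∘ (n ∘ i))        ≈⟨ assoc ⟨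
      (j ∘ inv) ∘ (n ∘ i)        ≈⟨ isoʳ ⟩∘ _ ⟩
      idₘ ∘ (n ∘ i)              ≈⟨ identityˡ ⟩
      n ∘ i                      ∎
      where open IsIso j-iso

    conjugateʳ : (i-iso : IsIso K i) → (j ∘ m) ∘ IsIso.inv i-iso ≈ n → j ∘ m ≈ n ∘ i
    conjugateʳ i-iso q = begin
      j ∘ m                      ≈⟨ identityʳ ⟨
      (j ∘ m) ∘ idₘ              ≈⟨ _ ∘⟨ isoˡ ⟨
      (j ∘ m) ∘ (inv ∘ i)        ≈⟨ assoc ⟨
      ((j ∘ m) ∘ inv) ∘ i        ≈⟨ q ⟩∘ _ ⟩
      n ∘ i                      ∎
      where open IsIso i-iso

-- Coherence of finite products

module CartesianCoherence {Obj : Set o} {C : Category Obj ℓ e}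
                          (T : Terminal C) (B : BinaryProducts C) where
  open Category C
  open Terminal T
  open BinaryProducts B
  open HomReasoning C
  open SymmetricPremonoidalData (cartesian T B) using (a; l; r; c)

  ⟨⟩-cong : ∀ {X Y Z} {f f′ : Z ⇒ X} {g g′ : Z ⇒ Y} →
            f ≈ f′ → g ≈ g′ → ⟨ f , g ⟩ ≈ ⟨ f′ , g′ ⟩
  ⟨⟩-cong q s = unique (≈-trans project₁ q) (≈-trans project₂ s)

  ⟨⟩-∘ : ∀ {W X Y Z} {f : Z ⇒ X} {g : Z ⇒ Y} {h : W ⇒ Z} →
         ⟨ f , g ⟩ ∘ h ≈ ⟨ f ∘ h , g ∘ h ⟩
  ⟨⟩-∘ {h = h} = unique (≈-trans (≈-sym assoc) (project₁ ⟩∘ h))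
                        (≈-trans (≈-sym assoc) (project₂ ⟩∘ h))

  ⟨⟩-η : ∀ {X Y Z} {h : Z ⇒ X ⊠ Y} → ⟨ π₁ ∘ h , π₂ ∘ h ⟩ ≈ h
  ⟨⟩-η = ≈-sym (unique ≈-refl ≈-refl)

  -- Equality of morphisms out of a product is checked on generalized elements:
  -- morphisms of the form ⟨ x , y ⟩ (nested as the domain is).

  ext₂ : ∀ {X Y Z} {f g : X ⊠ Y ⇒ Z} →
         (∀ {W} (x : W ⇒ X) (y : W ⇒ Y) → f ∘ ⟨ x , y ⟩ ≈ g ∘ ⟨ x , y ⟩) → f ≈ g
  ext₂ {f = f} {g} q = begin
    f                                    ≈⟨ identityʳ ⟨
    f ∘ idₘ                              ≈⟨ f ∘⟨ ⟨⟩-η ⟨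
    f ∘ ⟨ π₁ ∘ idₘ , π₂ ∘ idₘ ⟩          ≈⟨ q _ _ ⟩
    g ∘ ⟨ π₁ ∘ idₘ , π₂ ∘ idₘ ⟩          ≈⟨ g ∘⟨ ⟨⟩-η ⟩
    g ∘ idₘ                              ≈⟨ identityʳ ⟩
    g                                    ∎

  ext₃ : ∀ {X Y Z U} {f g : (X ⊠ Y) ⊠ Z ⇒ U} →
         (∀ {W} (x : W ⇒ X) (y : W ⇒ Y) (z : W ⇒ Z) →
            f ∘ ⟨ ⟨ x , y ⟩ , z ⟩ ≈ g ∘ ⟨ ⟨ x , y ⟩ , z ⟩) → f ≈ g
  ext₃ {f = f} {g} q = ext₂ λ xy z →
    let s = ⟨⟩-cong (⟨⟩-η {h = xy}) (≈-refl {x = z})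
    in ≈-trans (f ∘⟨ ≈-sym s) (≈-trans (q _ _ z) (g ∘⟨ s))

  ext₃ʳ : ∀ {X Y Z U} {f g : X ⊠ (Y ⊠ Z) ⇒ U} →
          (∀ {W} (x : W ⇒ X) (y : W ⇒ Y) (z : W ⇒ Z) →
             f ∘ ⟨ x , ⟨ y , z ⟩ ⟩ ≈ g ∘ ⟨ x , ⟨ y , z ⟩ ⟩) → f ≈ g
  ext₃ʳ {f = f} {g} q = ext₂ λ x yz →
    let s = ⟨⟩-cong (≈-refl {x = x}) (⟨⟩-η {h = yz})
    in ≈-trans (f ∘⟨ ≈-sym s) (≈-trans (q x _ _) (g ∘⟨ s))

  ext₄ : ∀ {X Y Z U V} {f g : ((X ⊠ Y) ⊠ Z) ⊠ U ⇒ V} →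
         (∀ {W} (x : W ⇒ X) (y : W ⇒ Y) (z : W ⇒ Z) (u : W ⇒ U) →
            f ∘ ⟨ ⟨ ⟨ x , y ⟩ , z ⟩ , u ⟩ ≈ g ∘ ⟨ ⟨ ⟨ x , y ⟩ , z ⟩ , u ⟩) → f ≈ g
  ext₄ {f = f} {g} q = ext₃ λ xy z u →
    let s = ⟨⟩-cong (⟨⟩-cong (⟨⟩-η {h = xy}) (≈-refl {x = z})) (≈-refl {x = u})
    in ≈-trans (f ∘⟨ ≈-sym s) (≈-trans (q _ _ z u) (g ∘⟨ s))

  -- The structural morphisms act on generalized elements as expected.

  module _ {W : Obj} where

    ⊠₁-el : ∀ {X Y X′ Y′} {f : X ⇒ X′} {g : Y ⇒ Y′} {x : W ⇒ X} {y : W ⇒ Y} →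
            (f ⊠₁ g) ∘ ⟨ x , y ⟩ ≈ ⟨ f ∘ x , g ∘ y ⟩
    ⊠₁-el {f = f} {g} = ≈-trans ⟨⟩-∘ (⟨⟩-cong (≈-trans assoc (f ∘⟨ project₁))
                                              (≈-trans assoc (g ∘⟨ project₂)))

    first-el : ∀ {X Y X′} {f : X ⇒ X′} {x : W ⇒ X} {x′ : W ⇒ X′} {y : W ⇒ Y} →
               f ∘ x ≈ x′ → (f ⊠₁ idₘ) ∘ ⟨ x , y ⟩ ≈ ⟨ x′ , y ⟩
    first-el q = ≈-trans ⊠₁-el (⟨⟩-cong q identityˡ)

    second-el : ∀ {X Y Y′} {f : Y ⇒ Y′} {x : W ⇒ X} {y : W ⇒ Y} {y′ : W ⇒ Y′} →
                f ∘ y ≈ y′ → (idₘ ⊠₁ f) ∘ ⟨ x , y ⟩ ≈ ⟨ x , y′ ⟩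
    second-el q = ≈-trans ⊠₁-el (⟨⟩-cong identityˡ q)

    c-el : ∀ {X Y} {x : W ⇒ X} {y : W ⇒ Y} → c X Y ∘ ⟨ x , y ⟩ ≈ ⟨ y , x ⟩
    c-el = ≈-trans ⟨⟩-∘ (⟨⟩-cong project₂ project₁)

    a-el : ∀ {X Y Z} {x : W ⇒ X} {y : W ⇒ Y} {z : W ⇒ Z} →
           a X Y Z ∘ ⟨ ⟨ x , y ⟩ , z ⟩ ≈ ⟨ x , ⟨ y , z ⟩ ⟩
    a-el = ≈-trans ⟨⟩-∘ (⟨⟩-cong
      (≈-trans assoc (≈-trans (π₁ ∘⟨ project₁) project₁))
      (≈-trans ⟨⟩-∘ (⟨⟩-cong
        (≈-trans assoc (≈-trans (π₂ ∘⟨ project₁) project₂)) project₂)))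

  a⁻¹ : ∀ X Y Z → X ⊠ (Y ⊠ Z) ⇒ (X ⊠ Y) ⊠ Z
  a⁻¹ _ _ _ = ⟨ ⟨ π₁ , π₁ ∘ π₂ ⟩ , π₂ ∘ π₂ ⟩

  a⁻¹-el : ∀ {W X Y Z} {x : W ⇒ X} {y : W ⇒ Y} {z : W ⇒ Z} →
           a⁻¹ X Y Z ∘ ⟨ x , ⟨ y , z ⟩ ⟩ ≈ ⟨ ⟨ x , y ⟩ , z ⟩
  a⁻¹-el = ≈-trans ⟨⟩-∘ (⟨⟩-cong
    (≈-trans ⟨⟩-∘ (⟨⟩-cong project₁
      (≈-trans assoc (≈-trans (π₁ ∘⟨ project₂) project₁))))
    (≈-trans assoc (≈-trans (π₂ ∘⟨ project₂) project₂)))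

  -- Chains of structural morphisms are evaluated from the right.
  then : ∀ {W X Y Z} {f : X ⇒ Y} {g : Y ⇒ Z} {x : W ⇒ X} {y : W ⇒ Y} {z : W ⇒ Z} →
         f ∘ x ≈ y → g ∘ y ≈ z → (g ∘ f) ∘ x ≈ z
  then {g = g} q s = ≈-trans assoc (≈-trans (g ∘⟨ q) s)

  a-iso : ∀ X Y Z → IsIso C (a X Y Z)
  a-iso X Y Z = record
    { inv  = a⁻¹ X Y Z
    ; isoˡ = ext₃  λ _ _ _ → ≈-trans (then a-el a⁻¹-el) (≈-sym identityˡ)
    ; isoʳ = ext₃ʳ λ _ _ _ → ≈-trans (then a⁻¹-el a-el) (≈-sym identityˡ)
    }

  c-invol : ∀ X Y → c Y X ∘ c X Y ≈ idₘ
  c-invol X Y = ext₂ λ _ _ → ≈-trans (then c-el c-el) (≈-sym identityˡ)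

  c-iso : ∀ X Y → IsIso C (c X Y)
  c-iso X Y = record { inv = c Y X ; isoˡ = c-invol X Y ; isoʳ = c-invol Y X }

  into-𝟏 : ∀ {X} {f g : X ⇒ 𝟏} → f ≈ g
  into-𝟏 = ≈-trans (!-unique _) (≈-sym (!-unique _))

  l-iso : ∀ X → IsIso C (l X)
  l-iso X = record
    { inv  = ⟨ idₘ , ! ⟩
    ; isoˡ = ext₂ λ x _ → begin
        (⟨ idₘ , ! ⟩ ∘ π₁) ∘ ⟨ x , _ ⟩  ≈⟨ then project₁ ⟨⟩-∘ ⟩
        ⟨ idₘ ∘ x , ! ∘ x ⟩            ≈⟨ ⟨⟩-cong identityˡ into-𝟏 ⟩
        ⟨ x , _ ⟩                      ≈⟨ identityˡ ⟨
        idₘ ∘ ⟨ x , _ ⟩                ∎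
    ; isoʳ = project₁
    }

  r-iso : ∀ X → IsIso C (r X)
  r-iso X = record
    { inv  = ⟨ ! , idₘ ⟩
    ; isoˡ = ext₂ λ _ x → begin
        (⟨ ! , idₘ ⟩ ∘ π₂) ∘ ⟨ _ , x ⟩  ≈⟨ then project₂ ⟨⟩-∘ ⟩
        ⟨ ! ∘ x , idₘ ∘ x ⟩            ≈⟨ ⟨⟩-cong into-𝟏 identityˡ ⟩
        ⟨ _ , x ⟩                      ≈⟨ identityˡ ⟨
        idₘ ∘ ⟨ _ , x ⟩                ∎
    ; isoʳ = project₂
    }

  pentagon : ∀ W X Y Z → (idₘ ⊠₁ a X Y Z) ∘ a W (X ⊠ Y) Z ∘ (a W X Y ⊠₁ idₘ)
                           ≈ a W X (Y ⊠ Z) ∘ a (W ⊠ X) Y Z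
  pentagon _ _ _ _ = ext₄ λ _ _ _ _ →
    ≈-trans (then (then (first-el a-el) a-el) (second-el a-el))
            (≈-sym (then a-el a-el))

  triangle : ∀ X Y → (idₘ ⊠₁ r Y) ∘ a X 𝟏 Y ≈ l X ⊠₁ idₘ
  triangle _ _ = ext₃ λ _ _ _ →
    ≈-trans (then a-el (second-el project₂)) (≈-sym (first-el project₁))

  hexagon : ∀ X Y Z → (idₘ ⊠₁ c X Z) ∘ a Y X Z ∘ (c X Y ⊠₁ idₘ)
                        ≈ a Y Z X ∘ c X (Y ⊠ Z) ∘ a X Y Z
  hexagon _ _ _ = ext₃ λ _ _ _ →
    ≈-trans (then (then (first-el c-el) a-el) (second-el c-el))
            (≈-sym (then (then a-el c-el) a-el))

  ⊠₁-id : ∀ {X Y} → idₘ {X} ⊠₁ idₘ {Y} ≈ idₘ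
  ⊠₁-id = ext₂ λ _ _ → ≈-trans (first-el identityˡ) (≈-sym identityˡ)

  -- Projections of a and of its inverse, and the cancellations that they entail.

  π₁-a : ∀ X Y Z → π₁ ∘ a X Y Z ≈ π₁ ∘ π₁
  π₁-a _ _ _ = project₁

  π₂-a : ∀ X Y Z → π₂ ∘ a X Y Z ≈ π₂ ⊠₁ idₘ
  π₂-a _ _ _ = ≈-trans project₂ (⟨⟩-cong ≈-refl (≈-sym identityˡ))

  π₁-a⁻¹ : ∀ X Y Z → π₁ ∘ a⁻¹ X Y Z ≈ idₘ ⊠₁ π₁
  π₁-a⁻¹ _ _ _ = ≈-trans project₁ (⟨⟩-cong (≈-sym identityˡ) ≈-refl)

  π₂-a⁻¹ : ∀ X Y Z → π₂ ∘ a⁻¹ X Y Z ≈ π₂ ∘ π₂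
  π₂-a⁻¹ _ _ _ = project₂

  ⊠π₁-a : ∀ X Y Z → (idₘ ⊠₁ π₁) ∘ a X Y Z ≈ π₁
  ⊠π₁-a _ _ _ = ext₃ λ _ _ _ →
    ≈-trans (then a-el (second-el project₁)) (≈-sym project₁)

  π₂π₂-a : ∀ X Y Z → π₂ ∘ π₂ ∘ a X Y Z ≈ π₂
  π₂π₂-a _ _ _ = ≈-trans (π₂ ∘⟨ project₂) project₂

  π₂⊠-a⁻¹ : ∀ X Y Z → (π₂ ⊠₁ idₘ) ∘ a⁻¹ X Y Z ≈ π₂
  π₂⊠-a⁻¹ _ _ _ = ext₃ʳ λ _ _ _ →
    ≈-trans (then a⁻¹-el (first-el project₂)) (≈-sym project₂)

  π₁π₁-a⁻¹ : ∀ X Y Z → π₁ ∘ π₁ ∘ a⁻¹ X Y Z ≈ π₁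
  π₁π₁-a⁻¹ _ _ _ = ≈-trans (π₁ ∘⟨ project₁) project₁

-- Semi-pure products

module SemipureProperties {Obj : Set o} (E : CartesianEffectCategory Obj ℓ e p κ) where
  open CartesianEffectCategory E
  open HomReasoning K
  module × = CartesianCoherence terminal products

  -- Composing both sides of a consistency with the same pure morphism: condition
  -- (ii) with u an identity.

  ◁-∘-pure : ∀ {X Y Z} {g : Y ⇒ Z} (w : Y ⇝ Z) (u : X ⇝ Y) →
             g ◁ w → g ∘ J u ◁ w Cᶜ.∘ u
  ◁-∘-pure {g = g} w u q =
    ◁-∘ (J u) g Cᶜ.idₘ u w
        (◁-resp-≈ (≈-sym identityˡ) ≈-refl (◁-pure u))
        (◁-resp-≈ ≈-refl (≈-sym identityʳ) q)

  pure-∘-◁ : ∀ {X Y Z} {f : X ⇒ Y} (w : Y ⇝ Z) (v : X ⇝ Y) →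
             f ◁ v → J w ∘ f ◁ w Cᶜ.∘ v
  pure-∘-◁ {f = f} w v q =
    ◁-∘ f (J w) Cᶜ.idₘ v w
        (◁-resp-≈ (≈-sym identityˡ) ≈-refl q)
        (◁-resp-≈ ≈-refl (≈-sym identityʳ) (◁-pure w))

  ⋉ₛ-cong : ∀ {X₁ X₂ Y₁ Y₂} (v v′ : X₁ ⇝ Y₁) {f f′ : X₂ ⇒ Y₂} →
            J v ≈ J v′ → f ≈ f′ → v ⋉ₛ f ≈ v′ ⋉ₛ f′
  ⋉ₛ-cong v v′ {f} {f′} q s = GraphHom.F-resp-≈ semipureˡ {f = v , f} {g = v′ , f′} (q , s)

  ⋊ₛ-cong : ∀ {X₁ X₂ Y₁ Y₂} {f f′ : X₁ ⇒ Y₁} (v v′ : X₂ ⇝ Y₂) →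
            f ≈ f′ → J v ≈ J v′ → f ⋊ₛ v ≈ f′ ⋊ₛ v′
  ⋊ₛ-cong {f = f} {f′} v v′ q s = GraphHom.F-resp-≈ semipureʳ {f = f , v} {g = f′ , v′} (q , s)

  -- Semi-pure products compose: condition (ii) on the consistency relation,
  -- with u a projection, gives the consistency part of the characterization.

  ⋉ₛ-∘ : ∀ {X₁ X₂ Y₁ Y₂ Z₁ Z₂} (v : X₁ ⇝ Y₁) (w : Y₁ ⇝ Z₁) (f : X₂ ⇒ Y₂) (g : Y₂ ⇒ Z₂) →
         (w ⋉ₛ g) ∘ (v ⋉ₛ f) ≈ (w Cᶜ.∘ v) ⋉ₛ (g ∘ f)
  ⋉ₛ-∘ v w f g = ⋉ₛ-unique (w Cᶜ.∘ v) (g ∘ f) _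
    (◁-resp-≈ assoc (≈-sym assoc)
      (◁-∘ (v ⋉ₛ f) (J π₁ ∘ (w ⋉ₛ g)) π₁ (v Cᶜ.∘ π₁) w (⋉ₛ-proj₁ v f) (⋉ₛ-proj₁ w g)))
    (begin
      J π₂ ∘ ((w ⋉ₛ g) ∘ (v ⋉ₛ f))  ≈⟨ assoc ⟨
      (J π₂ ∘ (w ⋉ₛ g)) ∘ (v ⋉ₛ f)  ≈⟨ ⋉ₛ-proj₂ w g ⟩∘ _ ⟩
      (g ∘ J π₂) ∘ (v ⋉ₛ f)         ≈⟨ assoc ⟩
      g ∘ (J π₂ ∘ (v ⋉ₛ f))         ≈⟨ g ∘⟨ ⋉ₛ-proj₂ v f ⟩
      g ∘ (f ∘ J π₂)                ≈⟨ assoc ⟨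
      (g ∘ f) ∘ J π₂                ∎)

  ⋊ₛ-∘ : ∀ {X₁ X₂ Y₁ Y₂ Z₁ Z₂} (f : X₁ ⇒ Y₁) (g : Y₁ ⇒ Z₁) (v : X₂ ⇝ Y₂) (w : Y₂ ⇝ Z₂) →
         (g ⋊ₛ w) ∘ (f ⋊ₛ v) ≈ (g ∘ f) ⋊ₛ (w Cᶜ.∘ v)
  ⋊ₛ-∘ f g v w = ⋊ₛ-unique (g ∘ f) (w Cᶜ.∘ v) _
    (begin
      J π₁ ∘ ((g ⋊ₛ w) ∘ (f ⋊ₛ v))  ≈⟨ assoc ⟨
      (J π₁ ∘ (g ⋊ₛ w)) ∘ (f ⋊ₛ v)  ≈⟨ ⋊ₛ-proj₁ g w ⟩∘ _ ⟩
      (g ∘ J π₁) ∘ (f ⋊ₛ v)         ≈⟨ assoc ⟩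
      g ∘ (J π₁ ∘ (f ⋊ₛ v))         ≈⟨ g ∘⟨ ⋊ₛ-proj₁ f v ⟩
      g ∘ (f ∘ J π₁)                ≈⟨ assoc ⟨
      (g ∘ f) ∘ J π₁                ∎)
    (◁-resp-≈ assoc (≈-sym assoc)
      (◁-∘ (f ⋊ₛ v) (J π₂ ∘ (g ⋊ₛ w)) π₂ (v Cᶜ.∘ π₂) w (⋊ₛ-proj₂ f v) (⋊ₛ-proj₂ g w)))

  ⋉ₛ-id : ∀ {X Y} → Cᶜ.idₘ {X} ⋉ₛ idₘ {Y} ≈ idₘ
  ⋉ₛ-id = ≈-trans (⋉ₛ-extends Cᶜ.idₘ Cᶜ.idₘ) ×.⊠₁-id

  ⋊ₛ-id : ∀ {X Y} → idₘ {X} ⋊ₛ Cᶜ.idₘ {Y} ≈ idₘ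
  ⋊ₛ-id = ≈-trans (⋊ₛ-extends Cᶜ.idₘ Cᶜ.idₘ) ×.⊠₁-id

  -- A pure and an arbitrary morphism, acting on different components, may be
  -- performed in either order.

  ⋉ₛ-interchange : ∀ {X₁ X₂ Y₁ Y₂} (v : X₁ ⇝ Y₁) (f : X₂ ⇒ Y₂) →
                   (Cᶜ.idₘ ⋉ₛ f) ∘ J (v ⊠₁ Cᶜ.idₘ) ≈ J (v ⊠₁ Cᶜ.idₘ) ∘ (Cᶜ.idₘ ⋉ₛ f)
  ⋉ₛ-interchange v f = begin
    (Cᶜ.idₘ ⋉ₛ f) ∘ J (v ⊠₁ Cᶜ.idₘ)   ≈⟨ _ ∘⟨ ⋉ₛ-extends v Cᶜ.idₘ ⟨
    (Cᶜ.idₘ ⋉ₛ f) ∘ (v ⋉ₛ idₘ)        ≈⟨ ⋉ₛ-∘ v Cᶜ.idₘ idₘ f ⟩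
    (Cᶜ.idₘ Cᶜ.∘ v) ⋉ₛ (f ∘ idₘ)      ≈⟨ ⋉ₛ-cong (Cᶜ.idₘ Cᶜ.∘ v) (v Cᶜ.∘ Cᶜ.idₘ)
                                           (≈-trans identityˡ (≈-sym identityʳ))
                                           (≈-trans identityʳ (≈-sym identityˡ)) ⟩
    (v Cᶜ.∘ Cᶜ.idₘ) ⋉ₛ (idₘ ∘ f)      ≈⟨ ⋉ₛ-∘ Cᶜ.idₘ v f idₘ ⟨
    (v ⋉ₛ idₘ) ∘ (Cᶜ.idₘ ⋉ₛ f)        ≈⟨ ⋉ₛ-extends v Cᶜ.idₘ ⟩∘ _ ⟩
    J (v ⊠₁ Cᶜ.idₘ) ∘ (Cᶜ.idₘ ⋉ₛ f)   ∎

  ⋊ₛ-interchange : ∀ {X₁ X₂ Y₁ Y₂} (f : X₁ ⇒ Y₁) (v : X₂ ⇝ Y₂) →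
                   (f ⋊ₛ Cᶜ.idₘ) ∘ J (Cᶜ.idₘ ⊠₁ v) ≈ J (Cᶜ.idₘ ⊠₁ v) ∘ (f ⋊ₛ Cᶜ.idₘ)
  ⋊ₛ-interchange f v = begin
    (f ⋊ₛ Cᶜ.idₘ) ∘ J (Cᶜ.idₘ ⊠₁ v)   ≈⟨ _ ∘⟨ ⋊ₛ-extends Cᶜ.idₘ v ⟨
    (f ⋊ₛ Cᶜ.idₘ) ∘ (idₘ ⋊ₛ v)        ≈⟨ ⋊ₛ-∘ idₘ f v Cᶜ.idₘ ⟩
    (f ∘ idₘ) ⋊ₛ (Cᶜ.idₘ Cᶜ.∘ v)      ≈⟨ ⋊ₛ-cong (Cᶜ.idₘ Cᶜ.∘ v) (v Cᶜ.∘ Cᶜ.idₘ)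
                                           (≈-trans identityʳ (≈-sym identityˡ))
                                           (≈-trans identityˡ (≈-sym identityʳ)) ⟩
    (idₘ ∘ f) ⋊ₛ (v Cᶜ.∘ Cᶜ.idₘ)      ≈⟨ ⋊ₛ-∘ f idₘ Cᶜ.idₘ v ⟨
    (idₘ ⋊ₛ v) ∘ (f ⋊ₛ Cᶜ.idₘ)        ≈⟨ ⋊ₛ-extends Cᶜ.idₘ v ⟩∘ _ ⟩
    J (Cᶜ.idₘ ⊠₁ v) ∘ (f ⋊ₛ Cᶜ.idₘ)   ∎

  open SymmetricPremonoidalData (cartesian terminal products) using (a; c)

  -- The inverse of J v is pure, being taken in C.
  J-iso : ∀ {X Y} {v : X ⇝ Y} → IsIso (WideSubcategory.category C) v → IsIso K (J v)
  J-iso i = record { inv = J inv ; isoˡ = isoˡ ; isoʳ = isoʳ }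
    where open IsIso i

  -- Naturality of the structural isomorphisms

  pushˡ : ∀ {W X Y Z} {q : Y ⇒ Z} {j : X ⇒ Y} {q′ : X ⇒ Z} {n : W ⇒ X} →
          q ∘ j ≈ q′ → q ∘ (j ∘ n) ≈ q′ ∘ n
  pushˡ {n = n} s = ≈-trans (≈-sym assoc) (s ⟩∘ n)

  a-natural₁ : ∀ {X X′} (f : X ⇒ X′) Y Z →
               J (a X′ Y Z) ∘ ((f ⋊ₛ Cᶜ.idₘ) ⋊ₛ Cᶜ.idₘ) ≈ (f ⋊ₛ Cᶜ.idₘ) ∘ J (a X Y Z)
  a-natural₁ {X} {X′} f Y Z = conjugateˡ (J-iso (×.a-iso X′ Y Z))
    (⋊ₛ-unique (f ⋊ₛ Cᶜ.idₘ) Cᶜ.idₘ _ first second)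
    where
    first : J π₁ ∘ (J (×.a⁻¹ X′ Y Z) ∘ ((f ⋊ₛ Cᶜ.idₘ) ∘ J (a X Y Z))) ≈ (f ⋊ₛ Cᶜ.idₘ) ∘ J π₁
    first = begin
      J π₁ ∘ (J (×.a⁻¹ X′ Y Z) ∘ ((f ⋊ₛ Cᶜ.idₘ) ∘ J (a X Y Z)))
        ≈⟨ pushˡ (×.π₁-a⁻¹ X′ Y Z) ⟩
      J (Cᶜ.idₘ ⊠₁ π₁) ∘ ((f ⋊ₛ Cᶜ.idₘ) ∘ J (a X Y Z))
        ≈⟨ pushˡ (≈-sym (⋊ₛ-interchange f π₁)) ⟩
      ((f ⋊ₛ Cᶜ.idₘ) ∘ J (Cᶜ.idₘ ⊠₁ π₁)) ∘ J (a X Y Z)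
        ≈⟨ assoc ⟩
      (f ⋊ₛ Cᶜ.idₘ) ∘ (J (Cᶜ.idₘ ⊠₁ π₁) ∘ J (a X Y Z))
        ≈⟨ _ ∘⟨ ×.⊠π₁-a X Y Z ⟩
      (f ⋊ₛ Cᶜ.idₘ) ∘ J π₁ ∎

    second : J π₂ ∘ (J (×.a⁻¹ X′ Y Z) ∘ ((f ⋊ₛ Cᶜ.idₘ) ∘ J (a X Y Z))) ◁ Cᶜ.idₘ Cᶜ.∘ π₂
    second = ◁-resp-≈
      (begin
        J π₂ ∘ ((J π₂ ∘ (f ⋊ₛ Cᶜ.idₘ)) ∘ J (a X Y Z))              ≈⟨ _ ∘⟨ assoc ⟩
        J π₂ ∘ (J π₂ ∘ ((f ⋊ₛ Cᶜ.idₘ) ∘ J (a X Y Z)))              ≈⟨ assoc ⟨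
        (J π₂ ∘ J π₂) ∘ ((f ⋊ₛ Cᶜ.idₘ) ∘ J (a X Y Z))              ≈⟨ pushˡ (×.π₂-a⁻¹ X′ Y Z) ⟨
        J π₂ ∘ (J (×.a⁻¹ X′ Y Z) ∘ ((f ⋊ₛ Cᶜ.idₘ) ∘ J (a X Y Z)))  ∎)
      (begin
        J π₂ ∘ ((idₘ ∘ J π₂) ∘ J (a X Y Z))  ≈⟨ _ ∘⟨ (identityˡ ⟩∘ _) ⟩
        J π₂ ∘ (J π₂ ∘ J (a X Y Z))          ≈⟨ ×.π₂π₂-a X Y Z ⟩
        J π₂                                 ≈⟨ identityˡ ⟨
        idₘ ∘ J π₂                           ∎)
      (pure-∘-◁ π₂ ((Cᶜ.idₘ Cᶜ.∘ π₂) Cᶜ.∘ a X Y Z)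
        (◁-∘-pure (Cᶜ.idₘ Cᶜ.∘ π₂) (a X Y Z) (⋊ₛ-proj₂ f Cᶜ.idₘ)))

  a-natural₂ : ∀ X {Y Y′} (f : Y ⇒ Y′) Z →
               J (a X Y′ Z) ∘ ((Cᶜ.idₘ ⋉ₛ f) ⋊ₛ Cᶜ.idₘ) ≈ (Cᶜ.idₘ ⋉ₛ (f ⋊ₛ Cᶜ.idₘ)) ∘ J (a X Y Z)
  a-natural₂ X {Y} {Y′} f Z = conjugateˡ (J-iso (×.a-iso X Y′ Z))
    (⋊ₛ-unique (Cᶜ.idₘ ⋉ₛ f) Cᶜ.idₘ _ first second)
    where
    -- Both composites below equal id ⋉ₛ (f ∘ π₁).
    slide : J (Cᶜ.idₘ ⊠₁ π₁) ∘ (Cᶜ.idₘ ⋉ₛ (f ⋊ₛ Cᶜ.idₘ))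
              ≈ (Cᶜ.idₘ ⋉ₛ f) ∘ J (Cᶜ.idₘ {X} ⊠₁ π₁ {Y} {Z})
    slide = begin
      J (Cᶜ.idₘ ⊠₁ π₁) ∘ (Cᶜ.idₘ ⋉ₛ (f ⋊ₛ Cᶜ.idₘ))  ≈⟨ ⋉ₛ-extends Cᶜ.idₘ π₁ ⟩∘ _ ⟨
      (Cᶜ.idₘ ⋉ₛ J π₁) ∘ (Cᶜ.idₘ ⋉ₛ (f ⋊ₛ Cᶜ.idₘ))  ≈⟨ ⋉ₛ-∘ Cᶜ.idₘ Cᶜ.idₘ _ _ ⟩
      (Cᶜ.idₘ Cᶜ.∘ Cᶜ.idₘ) ⋉ₛ (J π₁ ∘ (f ⋊ₛ Cᶜ.idₘ))
        ≈⟨ ⋉ₛ-cong (Cᶜ.idₘ Cᶜ.∘ Cᶜ.idₘ) (Cᶜ.idₘ Cᶜ.∘ Cᶜ.idₘ) ≈-refl (⋊ₛ-proj₁ f Cᶜ.idₘ) ⟩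
      (Cᶜ.idₘ Cᶜ.∘ Cᶜ.idₘ) ⋉ₛ (f ∘ J π₁)            ≈⟨ ⋉ₛ-∘ Cᶜ.idₘ Cᶜ.idₘ _ _ ⟨
      (Cᶜ.idₘ ⋉ₛ f) ∘ (Cᶜ.idₘ ⋉ₛ J π₁)              ≈⟨ _ ∘⟨ ⋉ₛ-extends Cᶜ.idₘ π₁ ⟩
      (Cᶜ.idₘ ⋉ₛ f) ∘ J (Cᶜ.idₘ ⊠₁ π₁)              ∎

    first : J π₁ ∘ (J (×.a⁻¹ X Y′ Z) ∘ ((Cᶜ.idₘ ⋉ₛ (f ⋊ₛ Cᶜ.idₘ)) ∘ J (a X Y Z)))
              ≈ (Cᶜ.idₘ ⋉ₛ f) ∘ J π₁
    first = begin
      J π₁ ∘ (J (×.a⁻¹ X Y′ Z) ∘ ((Cᶜ.idₘ ⋉ₛ (f ⋊ₛ Cᶜ.idₘ)) ∘ J (a X Y Z)))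
        ≈⟨ pushˡ (×.π₁-a⁻¹ X Y′ Z) ⟩
      J (Cᶜ.idₘ ⊠₁ π₁) ∘ ((Cᶜ.idₘ ⋉ₛ (f ⋊ₛ Cᶜ.idₘ)) ∘ J (a X Y Z))
        ≈⟨ pushˡ slide ⟩
      ((Cᶜ.idₘ ⋉ₛ f) ∘ J (Cᶜ.idₘ ⊠₁ π₁)) ∘ J (a X Y Z)
        ≈⟨ assoc ⟩
      (Cᶜ.idₘ ⋉ₛ f) ∘ (J (Cᶜ.idₘ ⊠₁ π₁) ∘ J (a X Y Z))
        ≈⟨ _ ∘⟨ ×.⊠π₁-a X Y Z ⟩
      (Cᶜ.idₘ ⋉ₛ f) ∘ J π₁ ∎

    second : J π₂ ∘ (J (×.a⁻¹ X Y′ Z) ∘ ((Cᶜ.idₘ ⋉ₛ (f ⋊ₛ Cᶜ.idₘ)) ∘ J (a X Y Z)))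
               ◁ Cᶜ.idₘ Cᶜ.∘ π₂
    second = ◁-resp-≈
      (begin
        (J π₂ ∘ (f ⋊ₛ Cᶜ.idₘ)) ∘ (J π₂ ∘ J (a X Y Z))
          ≈⟨ assoc ⟩
        J π₂ ∘ ((f ⋊ₛ Cᶜ.idₘ) ∘ (J π₂ ∘ J (a X Y Z)))
          ≈⟨ _ ∘⟨ pushˡ (≈-sym (⋉ₛ-proj₂ Cᶜ.idₘ (f ⋊ₛ Cᶜ.idₘ))) ⟩
        J π₂ ∘ ((J π₂ ∘ (Cᶜ.idₘ ⋉ₛ (f ⋊ₛ Cᶜ.idₘ))) ∘ J (a X Y Z))
          ≈⟨ _ ∘⟨ assoc ⟩
        J π₂ ∘ (J π₂ ∘ ((Cᶜ.idₘ ⋉ₛ (f ⋊ₛ Cᶜ.idₘ)) ∘ J (a X Y Z)))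
          ≈⟨ assoc ⟨
        (J π₂ ∘ J π₂) ∘ ((Cᶜ.idₘ ⋉ₛ (f ⋊ₛ Cᶜ.idₘ)) ∘ J (a X Y Z))
          ≈⟨ pushˡ (×.π₂-a⁻¹ X Y′ Z) ⟨
        J π₂ ∘ (J (×.a⁻¹ X Y′ Z) ∘ ((Cᶜ.idₘ ⋉ₛ (f ⋊ₛ Cᶜ.idₘ)) ∘ J (a X Y Z))) ∎)
      (begin
        (idₘ ∘ J π₂) ∘ (J π₂ ∘ J (a X Y Z))  ≈⟨ assoc ⟩
        idₘ ∘ (J π₂ ∘ (J π₂ ∘ J (a X Y Z)))  ≈⟨ _ ∘⟨ ×.π₂π₂-a X Y Z ⟩
        idₘ ∘ J π₂                           ∎)
      (◁-∘-pure (Cᶜ.idₘ Cᶜ.∘ π₂) (π₂ Cᶜ.∘ a X Y Z) (⋊ₛ-proj₂ f Cᶜ.idₘ))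

  a-natural₃ : ∀ X Y {Z Z′} (f : Z ⇒ Z′) →
               J (a X Y Z′) ∘ (Cᶜ.idₘ ⋉ₛ f) ≈ (Cᶜ.idₘ ⋉ₛ (Cᶜ.idₘ ⋉ₛ f)) ∘ J (a X Y Z)
  a-natural₃ X Y {Z} {Z′} f = conjugateʳ (J-iso (×.a-iso X Y Z))
    (≈-trans assoc (⋉ₛ-unique Cᶜ.idₘ (Cᶜ.idₘ ⋉ₛ f) _ first second))
    where
    first : J π₁ ∘ (J (a X Y Z′) ∘ ((Cᶜ.idₘ ⋉ₛ f) ∘ J (×.a⁻¹ X Y Z))) ◁ Cᶜ.idₘ Cᶜ.∘ π₁
    first = ◁-resp-≈
      (begin
        J π₁ ∘ ((J π₁ ∘ (Cᶜ.idₘ ⋉ₛ f)) ∘ J (×.a⁻¹ X Y Z))            ≈⟨ _ ∘⟨ assoc ⟩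
        J π₁ ∘ (J π₁ ∘ ((Cᶜ.idₘ ⋉ₛ f) ∘ J (×.a⁻¹ X Y Z)))            ≈⟨ assoc ⟨
        (J π₁ ∘ J π₁) ∘ ((Cᶜ.idₘ ⋉ₛ f) ∘ J (×.a⁻¹ X Y Z))            ≈⟨ pushˡ (×.π₁-a X Y Z′) ⟨
        J π₁ ∘ (J (a X Y Z′) ∘ ((Cᶜ.idₘ ⋉ₛ f) ∘ J (×.a⁻¹ X Y Z)))    ∎)
      (begin
        J π₁ ∘ ((idₘ ∘ J π₁) ∘ J (×.a⁻¹ X Y Z))  ≈⟨ _ ∘⟨ (identityˡ ⟩∘ _) ⟩
        J π₁ ∘ (J π₁ ∘ J (×.a⁻¹ X Y Z))          ≈⟨ ×.π₁π₁-a⁻¹ X Y Z ⟩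
        J π₁                                     ≈⟨ identityˡ ⟨
        idₘ ∘ J π₁                               ∎)
      (pure-∘-◁ π₁ ((Cᶜ.idₘ Cᶜ.∘ π₁) Cᶜ.∘ ×.a⁻¹ X Y Z)
        (◁-∘-pure (Cᶜ.idₘ Cᶜ.∘ π₁) (×.a⁻¹ X Y Z) (⋉ₛ-proj₁ Cᶜ.idₘ f)))

    second : J π₂ ∘ (J (a X Y Z′) ∘ ((Cᶜ.idₘ ⋉ₛ f) ∘ J (×.a⁻¹ X Y Z))) ≈ (Cᶜ.idₘ ⋉ₛ f) ∘ J π₂
    second = begin
      J π₂ ∘ (J (a X Y Z′) ∘ ((Cᶜ.idₘ ⋉ₛ f) ∘ J (×.a⁻¹ X Y Z)))
        ≈⟨ pushˡ (×.π₂-a X Y Z′) ⟩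
      J (π₂ ⊠₁ Cᶜ.idₘ) ∘ ((Cᶜ.idₘ ⋉ₛ f) ∘ J (×.a⁻¹ X Y Z))
        ≈⟨ pushˡ (≈-sym (⋉ₛ-interchange π₂ f)) ⟩
      ((Cᶜ.idₘ ⋉ₛ f) ∘ J (π₂ ⊠₁ Cᶜ.idₘ)) ∘ J (×.a⁻¹ X Y Z)
        ≈⟨ assoc ⟩
      (Cᶜ.idₘ ⋉ₛ f) ∘ (J (π₂ ⊠₁ Cᶜ.idₘ) ∘ J (×.a⁻¹ X Y Z))
        ≈⟨ _ ∘⟨ ×.π₂⊠-a⁻¹ X Y Z ⟩
      (Cᶜ.idₘ ⋉ₛ f) ∘ J π₂ ∎

  c-natural₁ : ∀ {X X′} (f : X ⇒ X′) Y →
               J (c X′ Y) ∘ (f ⋊ₛ Cᶜ.idₘ) ≈ (Cᶜ.idₘ ⋉ₛ f) ∘ J (c X Y)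
  c-natural₁ {X} {X′} f Y = conjugateʳ (J-iso (×.c-iso X Y))
    (≈-trans assoc (⋉ₛ-unique Cᶜ.idₘ f _ first second))
    where
    π₁-c : ∀ X Y → J π₁ ∘ J (c X Y) ≈ J π₂
    π₁-c _ _ = project₁ {f = π₂} {g = π₁}

    π₂-c : ∀ X Y → J π₂ ∘ J (c X Y) ≈ J π₁
    π₂-c _ _ = project₂ {f = π₂} {g = π₁}

    first : J π₁ ∘ (J (c X′ Y) ∘ ((f ⋊ₛ Cᶜ.idₘ) ∘ J (c Y X))) ◁ Cᶜ.idₘ Cᶜ.∘ π₁
    first = ◁-resp-≈
      (begin
        (J π₂ ∘ (f ⋊ₛ Cᶜ.idₘ)) ∘ J (c Y X)                 ≈⟨ assoc ⟩
        J π₂ ∘ ((f ⋊ₛ Cᶜ.idₘ) ∘ J (c Y X))                 ≈⟨ pushˡ (π₁-c X′ Y) ⟨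
        J π₁ ∘ (J (c X′ Y) ∘ ((f ⋊ₛ Cᶜ.idₘ) ∘ J (c Y X)))  ∎)
      (≈-trans assoc (_ ∘⟨ π₂-c Y X))
      (◁-∘-pure (Cᶜ.idₘ Cᶜ.∘ π₂) (c Y X) (⋊ₛ-proj₂ f Cᶜ.idₘ))

    second : J π₂ ∘ (J (c X′ Y) ∘ ((f ⋊ₛ Cᶜ.idₘ) ∘ J (c Y X))) ≈ f ∘ J π₂
    second = begin
      J π₂ ∘ (J (c X′ Y) ∘ ((f ⋊ₛ Cᶜ.idₘ) ∘ J (c Y X)))  ≈⟨ pushˡ (π₂-c X′ Y) ⟩
      J π₁ ∘ ((f ⋊ₛ Cᶜ.idₘ) ∘ J (c Y X))                 ≈⟨ pushˡ (⋊ₛ-proj₁ f Cᶜ.idₘ) ⟩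
      (f ∘ J π₁) ∘ J (c Y X)                             ≈⟨ assoc ⟩
      f ∘ (J π₁ ∘ J (c Y X))                             ≈⟨ f ∘⟨ π₁-c Y X ⟩
      f ∘ J π₂                                           ∎

  -- The square of c-natural₁ with its vertical sides c inverted.
  c-natural₂ : ∀ X {Y Y′} (f : Y ⇒ Y′) →
               J (c X Y′) ∘ (Cᶜ.idₘ ⋉ₛ f) ≈ (f ⋊ₛ Cᶜ.idₘ) ∘ J (c X Y)
  c-natural₂ X {Y} {Y′} f = conjugateʳ (J-iso (×.c-iso X Y)) (begin
    (J (c X Y′) ∘ (Cᶜ.idₘ ⋉ₛ f)) ∘ J (c Y X)   ≈⟨ assoc ⟩
    J (c X Y′) ∘ ((Cᶜ.idₘ ⋉ₛ f) ∘ J (c Y X))   ≈⟨ _ ∘⟨ c-natural₁ f X ⟨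
    J (c X Y′) ∘ (J (c Y′ X) ∘ (f ⋊ₛ Cᶜ.idₘ))  ≈⟨ pushˡ (×.c-invol Y′ X) ⟩
    idₘ ∘ (f ⋊ₛ Cᶜ.idₘ)                        ≈⟨ identityˡ ⟩
    f ⋊ₛ Cᶜ.idₘ                                ∎)

-- The Freyd-category

module FreydProperties {Obj : Set o} (E : CartesianEffectCategory Obj ℓ e p κ) where
  open CartesianEffectCategory E
  open HomReasoning K
  open SemipureProperties E
  open FreydData (freydData E) using (premonoidal)
  open SymmetricPremonoidalData premonoidal

  -- On an identity, the sequential products reduce to semi-pure products.  The
  -- identities of ∣ K ∣ are the morphisms equal to an identity up to ≈.

  ⋉-identity : ∀ {X Y Z} {u : X ⇒ X} (f : Y ⇒ Z) → u ≈ idₘ → u ⋉ f ≈ Cᶜ.idₘ ⋉ₛ f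
  ⋉-identity f q = ≈-trans
    (_ ∘⟨ ≈-trans (⋊ₛ-cong Cᶜ.idₘ Cᶜ.idₘ q ≈-refl) ⋊ₛ-id) identityʳ

  ⋊-identity : ∀ {X Y Z} {u : X ⇒ X} (f : Y ⇒ Z) → u ≈ idₘ → f ⋊ u ≈ f ⋊ₛ Cᶜ.idₘ
  ⋊-identity f q = ≈-trans
    (_ ∘⟨ ≈-trans (⋉ₛ-cong Cᶜ.idₘ Cᶜ.idₘ ≈-refl q) ⋉ₛ-id) identityʳ

  id⊗-≈ : ∀ X {Y Z} (f : Y ⇒ Z) → id[ X ]⊗ f ≈ Cᶜ.idₘ ⋉ₛ f
  id⊗-≈ X f = ⋉-identity f ≈-refl

  ⊗id-≈ : ∀ {Y Z} (f : Y ⇒ Z) X → f ⊗id[ X ] ≈ f ⋊ₛ Cᶜ.idₘ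
  ⊗id-≈ f X = ⋊-identity f ≈-refl

  id⊗-pure : ∀ X {Y Z} (v : Y ⇝ Z) → id[ X ]⊗ J v ≈ J (Cᶜ.idₘ ⊠₁ v)
  id⊗-pure X v = ≈-trans (id⊗-≈ X (J v)) (⋉ₛ-extends Cᶜ.idₘ v)

  ⊗id-pure : ∀ {Y Z} (v : Y ⇝ Z) X → J v ⊗id[ X ] ≈ J (v ⊠₁ Cᶜ.idₘ)
  ⊗id-pure v X = ≈-trans (⊗id-≈ (J v) X) (⋊ₛ-extends v Cᶜ.idₘ)

  id⊗-cong : ∀ X {Y Z} {f g : Y ⇒ Z} → f ≈ g → id[ X ]⊗ f ≈ id[ X ]⊗ g
  id⊗-cong X {f = f} {g} q =
    GraphHom.F-resp-≈ ⊗ˡ {f = Category.idₘ ∣ K ∣ , f} {g = Category.idₘ ∣ K ∣ , g} (≈-refl , q)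

  ⊗id-cong : ∀ {Y Z} {f g : Y ⇒ Z} X → f ≈ g → f ⊗id[ X ] ≈ g ⊗id[ X ]
  ⊗id-cong {f = f} {g} X q =
    GraphHom.F-resp-≈ ⊗ʳ {f = f , Category.idₘ ∣ K ∣} {g = g , Category.idₘ ∣ K ∣} (q , ≈-refl)

  ⋉Fr-≈ : ∀ {X₁ X₂ Y₁ Y₂} (f₁ : X₁ ⇒ Y₁) (f₂ : X₂ ⇒ Y₂) → f₁ ⋉Fr f₂ ≈ f₁ ⋉ f₂
  ⋉Fr-≈ f₁ f₂ = ∘-resp-≈ (id⊗-≈ _ f₂) (⊗id-≈ f₁ _)

  ⋊Fr-≈ : ∀ {X₁ X₂ Y₁ Y₂} (f₁ : X₁ ⇒ Y₁) (f₂ : X₂ ⇒ Y₂) → f₁ ⋊Fr f₂ ≈ f₁ ⋊ f₂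
  ⋊Fr-≈ f₁ f₂ = ∘-resp-≈ (⊗id-≈ f₁ _) (id⊗-≈ _ f₂)

  pure-central : ∀ {X Y} (v : X ⇝ Y) → Central (J v)
  pure-central v f =
    (begin
      J v ⋉Fr f                          ≈⟨ ∘-resp-≈ (id⊗-≈ _ f) (⊗id-pure v _) ⟩
      (Cᶜ.idₘ ⋉ₛ f) ∘ J (v ⊠₁ Cᶜ.idₘ)    ≈⟨ ⋉ₛ-interchange v f ⟩
      J (v ⊠₁ Cᶜ.idₘ) ∘ (Cᶜ.idₘ ⋉ₛ f)    ≈⟨ ∘-resp-≈ (⊗id-pure v _) (id⊗-≈ _ f) ⟨
      J v ⋊Fr f                          ∎) ,
    (begin
      f ⋉Fr J v                          ≈⟨ ∘-resp-≈ (id⊗-pure _ v) (⊗id-≈ f _) ⟩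
      J (Cᶜ.idₘ ⊠₁ v) ∘ (f ⋊ₛ Cᶜ.idₘ)    ≈⟨ ⋊ₛ-interchange f v ⟨
      (f ⋊ₛ Cᶜ.idₘ) ∘ J (Cᶜ.idₘ ⊠₁ v)    ≈⟨ ∘-resp-≈ (⊗id-≈ f _) (id⊗-pure _ v) ⟨
      f ⋊Fr J v                          ∎)

  ⊗ˡ-isFunctor : IsFunctor ⊗ˡ
  ⊗ˡ-isFunctor = record
    { identity     = ≈-trans (⋉-identity idₘ ≈-refl) ⋉ₛ-id
    ; homomorphism = λ { ((_ , is-id q) , f) ((_ , is-id s) , g) → begin
        _                                     ≈⟨ ⋉-identity (g ∘ f) (≈-trans (∘-resp-≈ s q) identityˡ) ⟩
        Cᶜ.idₘ ⋉ₛ (g ∘ f)                     ≈⟨ ⋉ₛ-cong Cᶜ.idₘ (Cᶜ.idₘ Cᶜ.∘ Cᶜ.idₘ) (≈-sym identityˡ) ≈-refl ⟩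
        (Cᶜ.idₘ Cᶜ.∘ Cᶜ.idₘ) ⋉ₛ (g ∘ f)       ≈⟨ ⋉ₛ-∘ Cᶜ.idₘ Cᶜ.idₘ f g ⟨
        (Cᶜ.idₘ ⋉ₛ g) ∘ (Cᶜ.idₘ ⋉ₛ f)         ≈⟨ ∘-resp-≈ (⋉-identity g s) (⋉-identity f q) ⟨
        _                                     ∎ }
    }

  ⊗ʳ-isFunctor : IsFunctor ⊗ʳ
  ⊗ʳ-isFunctor = record
    { identity     = ≈-trans (⋊-identity idₘ ≈-refl) ⋊ₛ-id
    ; homomorphism = λ { (f , (_ , is-id q)) (g , (_ , is-id s)) → begin
        _                                     ≈⟨ ⋊-identity (g ∘ f) (≈-trans (∘-resp-≈ s q) identityˡ) ⟩
        (g ∘ f) ⋊ₛ Cᶜ.idₘ                     ≈⟨ ⋊ₛ-cong Cᶜ.idₘ (Cᶜ.idₘ Cᶜ.∘ Cᶜ.idₘ) ≈-refl (≈-sym identityˡ) ⟩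
        (g ∘ f) ⋊ₛ (Cᶜ.idₘ Cᶜ.∘ Cᶜ.idₘ)       ≈⟨ ⋊ₛ-∘ f g Cᶜ.idₘ Cᶜ.idₘ ⟨
        (g ⋊ₛ Cᶜ.idₘ) ∘ (f ⋊ₛ Cᶜ.idₘ)         ≈⟨ ∘-resp-≈ (⋊-identity g s) (⋊-identity f q) ⟨
        _                                     ∎ }
    }

  isBinoidal : IsBinoidal binoidal
  isBinoidal = record
    { ⊗ˡ-isFunctor = ⊗ˡ-isFunctor
    ; ⊗ʳ-isFunctor = ⊗ʳ-isFunctor
    -- Both sides are equal to the identity.
    ; ⊗-coincide   = λ { (u₁ , is-id q) (u₂ , is-id s) → begin
        u₁ ⋉ u₂         ≈⟨ ⋉-identity u₂ q ⟩
        Cᶜ.idₘ ⋉ₛ u₂    ≈⟨ ⋉ₛ-cong Cᶜ.idₘ Cᶜ.idₘ ≈-refl s ⟩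
        Cᶜ.idₘ ⋉ₛ idₘ   ≈⟨ ≈-trans ⋉ₛ-id (≈-sym ⋊ₛ-id) ⟩
        idₘ ⋊ₛ Cᶜ.idₘ   ≈⟨ ⋊ₛ-cong Cᶜ.idₘ Cᶜ.idₘ q ≈-refl ⟨
        u₁ ⋊ₛ Cᶜ.idₘ    ≈⟨ ⋊-identity u₁ s ⟨
        u₁ ⋊ u₂         ∎ }
    }

  module ᶜ = SymmetricPremonoidalData (cartesian terminal products)

  isSymmetricPremonoidal : IsSymmetricPremonoidal premonoidal
  isSymmetricPremonoidal = record
    { isBinoidal = isBinoidal
    ; a-iso      = λ X Y Z → J-iso (×.a-iso X Y Z)
    ; l-iso      = λ X → J-iso (×.l-iso X)
    ; r-iso      = λ X → J-iso (×.r-iso X)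
    ; c-iso      = λ X Y → J-iso (×.c-iso X Y)
    ; a-central  = λ X Y Z → pure-central (ᶜ.a X Y Z)
    ; l-central  = λ X → pure-central (ᶜ.l X)
    ; r-central  = λ X → pure-central (ᶜ.r X)
    ; c-central  = λ X Y → pure-central (ᶜ.c X Y)
    ; a-natural₁ = λ {X} {X′} f Y Z → begin
        a X′ Y Z ∘ ((f ⊗id[ Y ]) ⊗id[ Z ])
          ≈⟨ _ ∘⟨ ≈-trans (⊗id-cong Z (⊗id-≈ f Y)) (⊗id-≈ _ Z) ⟩
        a X′ Y Z ∘ ((f ⋊ₛ Cᶜ.idₘ) ⋊ₛ Cᶜ.idₘ)
          ≈⟨ a-natural₁ f Y Z ⟩
        (f ⋊ₛ Cᶜ.idₘ) ∘ a X Y Z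
          ≈⟨ ⊗id-≈ f _ ⟩∘ _ ⟨
        (f ⊗id[ Y ⊠ Z ]) ∘ a X Y Z ∎
    ; a-natural₂ = λ X {Y} {Y′} f Z → begin
        a X Y′ Z ∘ ((id[ X ]⊗ f) ⊗id[ Z ])
          ≈⟨ _ ∘⟨ ≈-trans (⊗id-cong Z (id⊗-≈ X f)) (⊗id-≈ _ Z) ⟩
        a X Y′ Z ∘ ((Cᶜ.idₘ ⋉ₛ f) ⋊ₛ Cᶜ.idₘ)
          ≈⟨ a-natural₂ X f Z ⟩
        (Cᶜ.idₘ ⋉ₛ (f ⋊ₛ Cᶜ.idₘ)) ∘ a X Y Z
          ≈⟨ ≈-trans (id⊗-cong X (⊗id-≈ f Z)) (id⊗-≈ X _) ⟩∘ _ ⟨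
        (id[ X ]⊗ (f ⊗id[ Z ])) ∘ a X Y Z ∎
    ; a-natural₃ = λ X Y {Z} {Z′} f → begin
        a X Y Z′ ∘ (id[ X ⊠ Y ]⊗ f)
          ≈⟨ _ ∘⟨ id⊗-≈ _ f ⟩
        a X Y Z′ ∘ (Cᶜ.idₘ ⋉ₛ f)
          ≈⟨ a-natural₃ X Y f ⟩
        (Cᶜ.idₘ ⋉ₛ (Cᶜ.idₘ ⋉ₛ f)) ∘ a X Y Z
          ≈⟨ ≈-trans (id⊗-cong X (id⊗-≈ Y f)) (id⊗-≈ X _) ⟩∘ _ ⟨
        (id[ X ]⊗ (id[ Y ]⊗ f)) ∘ a X Y Z ∎
    ; l-natural  = λ f → ≈-trans (_ ∘⟨ ⊗id-≈ f _) (⋊ₛ-proj₁ f Cᶜ.idₘ)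
    ; r-natural  = λ f → ≈-trans (_ ∘⟨ id⊗-≈ _ f) (⋉ₛ-proj₂ Cᶜ.idₘ f)
    ; c-natural₁ = λ f Y → ≈-trans (_ ∘⟨ ⊗id-≈ f Y)
                             (≈-trans (c-natural₁ f Y) (≈-sym (id⊗-≈ Y f) ⟩∘ _))
    ; c-natural₂ = λ X f → ≈-trans (_ ∘⟨ id⊗-≈ X f)
                             (≈-trans (c-natural₂ X f) (≈-sym (⊗id-≈ f X) ⟩∘ _))
    ; pentagon   = λ W X Y Z → ≈-trans
        (∘-resp-≈ (id⊗-pure W (ᶜ.a X Y Z)) (_ ∘⟨ ⊗id-pure (ᶜ.a W X Y) Z))
        (×.pentagon W X Y Z)
    ; triangle   = λ X Y → ≈-trans (id⊗-pure X (ᶜ.r Y) ⟩∘ _)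
        (≈-trans (×.triangle X Y) (≈-sym (⊗id-pure (ᶜ.l X) Y)))
    ; hexagon    = λ X Y Z → ≈-trans
        (∘-resp-≈ (id⊗-pure Y (ᶜ.c X Z)) (_ ∘⟨ ⊗id-pure (ᶜ.c X Y) Z))
        (×.hexagon X Y Z)
    ; c-unit     = λ X → project₂ {f = π₂} {g = π₁}
    ; c-invol    = ×.c-invol
    }

  isStrict : IsStrictSymmetricPremonoidalFunctor (cartesian terminal products) premonoidal
               (WideSubcategory.inclusion C)
  isStrict = record
    { isSymmetricPremonoidalFunctor = record
      { isFunctor    = record { identity = ≈-refl ; homomorphism = λ _ _ → ≈-refl }
      ; preserves-⊗ˡ = λ X v → ≈-sym (id⊗-pure X v)
      ; preserves-⊗ʳ = λ v X → ≈-sym (⊗id-pure v X)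
      ; preserves-a  = λ _ _ _ → ≈-refl
      ; preserves-l  = λ _ → ≈-refl
      ; preserves-r  = λ _ → ≈-refl
      ; preserves-c  = λ _ _ → ≈-refl
      }
    -- The image of every morphism of C is central.
    ; preserves-central = λ v _ → pure-central v
    }

theorem16 : ∀ {o ℓ e p κ : Level} {Obj : Set o} (E : CartesianEffectCategory Obj ℓ e p κ) →
    let open CartesianEffectCategory E
        open SymmetricPremonoidalData (FreydData.premonoidal (freydData E))
    in IsFreydCategory (freydData E)
       × (∀ {X₁ X₂ Y₁ Y₂} (f₁ : X₁ ⇒ Y₁) (f₂ : X₂ ⇒ Y₂) → f₁ ⋉Fr f₂ ≈ f₁ ⋉ f₂)
       × (∀ {X₁ X₂ Y₁ Y₂} (f₁ : X₁ ⇒ Y₁) (f₂ : X₂ ⇒ Y₂) → f₁ ⋊Fr f₂ ≈ f₁ ⋊ f₂)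
theorem16 E =
  record { isSymmetricPremonoidal = isSymmetricPremonoidal ; isStrict = isStrict } ,
  ⋉Fr-≈ , ⋊Fr-≈
  where open FreydProperties E
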